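{- Let $r\geq3$ and $s\geq2$ be integers. Let $\Gamma$ be a finite connected bipartite graph with ordered bipartition $(B|B')$ that is not complete bipartite, let $1\neq N\lhd G\leq\mathrm{Aut}(\Gamma)$, and suppose that $\Gamma$ is $r$-starlike relative to $N$ and locally $(G,s)$-distance transitive. Then $s\leq4$. Moreover, if $s=4$, then the adjacency design $\mathcal{D}(\Gamma)$ is $N$-nicely affine with $r$ parallel classes of blocks, and $\Gamma$ has diameter $4$.
   Context: All graphs are finite, simple and without loops. Locally $(G,s)$-distance transitive: the graph has diameter at least $s$, $G$ is a subgroup of its automorphism group, and for each vertex $v$ and each $1\leq i\leq s$ the stabiliser $G_v$ is transitive on the set of vertices at distance $i$ from $v$. $r$-starlike: a connected bipartite graph with ordered bipartition $(B|B')$ is $r$-starlike relative to $N$ if $N\leq\mathrm{Aut}(\Gamma)$, $N$ is transitive on $B$, and $N$ has exactly $r$ orbits on $B'$. The adjacency design $\mathcal{D}(\Gamma)$ has point set $B$ and block set $B'$, a point and a block being incident if and only if they are adjacent in $\Gamma$. Automorphisms of a design are permutations of points and blocks preserving points, blocks and incidence. $N$-nicely affine: $N$ is a group of automorphisms of the design transitive on points, and there is a constant $\mu$ such that distinct blocks are incident with exactly $\mu$ common points if they are in different $N$-orbits and with no common point if they are in the same $N$-orbit. The $N$-orbits on blocks are the parallel classes. -}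

module Defs where

open import Data.Fin.Base using (Fin)
open import Data.Fin.Permutation
  using (Permutation′; _⟨$⟩ʳ_; inverseˡ; id; flip; _∘ₚ_; _≈_)
open import Data.Fin.Subset using (Subset; _∈_; _∉_)
open import Data.Fin.Subset.Properties using (_∈?_)
open import Data.List.Base using (allFin; filter; length)
open import Data.Nat.Base using (ℕ; zero; suc; _≤_)
open import Data.Product.Base using (∃; ∃-syntax; _×_; _,_; proj₁; proj₂)
open import Data.Sum.Base using (_⊎_)
open import Function.Bundles using (Bijection; _⇔_)
open import Level using (0ℓ)
open import Relation.Binary.Bundles using (Setoid)
open import Relation.Binary.Core using (Rel)
open import Relation.Binary.Definitions using (Decidable; Symmetric)
open import Relation.Binary.PropositionalEquality
  using (_≡_; _≢_; refl; sym; trans; cong; setoid)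
open import Relation.Nullary.Decidable using (¬?; _×-dec_)
open import Relation.Nullary.Negation using (¬_)
open import Relation.Unary using (Pred)

------------------------------------------------------------------------
-- Graphs

record Graph (n : ℕ) : Set₁ where
  field
    Adj       : Rel (Fin n) 0ℓ
    adj?      : Decidable Adj
    symmetric : Symmetric Adj
    loopless  : ∀ {v} → ¬ Adj v v

module _ {n : ℕ} (Γ : Graph n) where
  open Graph Γ

  data Walk : Fin n → Fin n → ℕ → Set where
    []  : ∀ {v} → Walk v v zero
    _∷_ : ∀ {u v w k} → Adj u v → Walk v w k → Walk u w (suc k)

  Connected : Set
  Connected = ∀ u v → ∃[ k ] Walk u v k

  -- Distance as a relation: there is no value when u and v lie in
  -- different components.
  Distance : Fin n → Fin n → ℕ → Set
  Distance u v k = Walk u v k × (∀ j → Walk u v j → k ≤ j)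

  HasDiameter : ℕ → Set
  HasDiameter d =
    (∀ u v → ∃[ k ] (Distance u v k × k ≤ d)) × (∃[ u ] ∃[ v ] Distance u v d)

  -- The ordered bipartition (B | B′); B′ is always the complement of B.
  IsBipartition : Subset n → Set
  IsBipartition B = ∀ {u v} → Adj u v → (u ∈ B × v ∉ B) ⊎ (u ∉ B × v ∈ B)

  IsCompleteBipartite : Set
  IsCompleteBipartite =
    ∃[ B ] (IsBipartition B × (∀ {u v} → u ∈ B → v ∉ B → Adj u v))

  IsAutomorphism : Pred (Permutation′ n) 0ℓ
  IsAutomorphism π = ∀ u v → Adj u v ⇔ Adj (π ⟨$⟩ʳ u) (π ⟨$⟩ʳ v)

------------------------------------------------------------------------
-- Permutation groups

-- Permutations are compared extensionally by _≈_, so membership has to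
-- respect it.
record PermGroup (n : ℕ) : Set₁ where
  field
    Mem       : Pred (Permutation′ n) 0ℓ
    respects  : ∀ {g h} → g ≈ h → Mem g → Mem h
    id-mem    : Mem id
    flip-mem  : ∀ {g} → Mem g → Mem (flip g)
    ∘ₚ-mem    : ∀ {g h} → Mem g → Mem h → Mem (g ∘ₚ h)

open PermGroup using (Mem)

module _ {n : ℕ} where

  infix 4 _⊑_ _◁_

  -- G ⊑ IsAutomorphism Γ says that G is a subgroup of Aut(Γ).
  _⊑_ : PermGroup n → Pred (Permutation′ n) 0ℓ → Set
  G ⊑ P = ∀ {g} → Mem G g → P g

  IsTrivial : PermGroup n → Set
  IsTrivial G = ∀ {g} → Mem G g → g ≈ id

  _◁_ : PermGroup n → PermGroup n → Set
  N ◁ G = (N ⊑ Mem G)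
        × (∀ {g h} → Mem G g → Mem N h → Mem N (flip g ∘ₚ h ∘ₚ g))

  Stabiliser : PermGroup n → Fin n → PermGroup n
  Stabiliser G v = record
    { Mem      = λ g → Mem G g × g ⟨$⟩ʳ v ≡ v
    ; respects = λ { g≈h (m , e) → G.respects g≈h m , trans (sym (g≈h v)) e }
    ; id-mem   = G.id-mem , refl
    ; flip-mem = λ { {g} (m , e) → G.flip-mem m
                   , trans (cong (flip g ⟨$⟩ʳ_) (sym e)) (inverseˡ g) }
    ; ∘ₚ-mem   = λ { {g} {h} (m , e) (m′ , e′) → G.∘ₚ-mem m m′
                   , trans (cong (h ⟨$⟩ʳ_) e) e′ }
    }
    where module G = PermGroup G

  SameOrbit : PermGroup n → Rel (Fin n) 0ℓ
  SameOrbit G x y = ∃[ g ] (Mem G g × g ⟨$⟩ʳ x ≡ y)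

  Invariant : PermGroup n → Pred (Fin n) 0ℓ → Set
  Invariant G P = ∀ {g x} → Mem G g → P x → P (g ⟨$⟩ʳ x)

  -- A group acts transitively on the empty set under this definition; a
  -- sphere Γᵢ(v) may be empty when i exceeds the eccentricity of v.
  TransitiveOn : PermGroup n → Pred (Fin n) 0ℓ → Set
  TransitiveOn G P = Invariant G P × (∀ {x y} → P x → P y → SameOrbit G x y)

  -- The set P with "same G-orbit" as its equality, i.e. the set of
  -- G-orbits on P when P is invariant.
  OrbitSetoid : PermGroup n → Pred (Fin n) 0ℓ → Setoid 0ℓ 0ℓ
  OrbitSetoid G P = record
    { Carrier       = ∃ P
    ; _≈_           = λ x y → SameOrbit G (proj₁ x) (proj₁ y)
    ; isEquivalence = record
      { refl  = id , G.id-mem , refl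
      ; sym   = λ { (g , m , e) → flip g , G.flip-mem m
                  , trans (cong (flip g ⟨$⟩ʳ_) (sym e)) (inverseˡ g) }
      ; trans = λ { (g , m , e) (h , m′ , e′) → g ∘ₚ h , G.∘ₚ-mem m m′
                  , trans (cong (h ⟨$⟩ʳ_) e) e′ }
      }
    }
    where module G = PermGroup G

  HasOrbits : PermGroup n → Pred (Fin n) 0ℓ → ℕ → Set
  HasOrbits G P r =
    Invariant G P × Bijection (OrbitSetoid G P) (setoid (Fin r))

------------------------------------------------------------------------
-- Group actions on graphs

module _ {n : ℕ} (Γ : Graph n) where

  IsLocallyDistanceTransitive : PermGroup n → ℕ → Set
  IsLocallyDistanceTransitive G s =
      (∃[ d ] (HasDiameter Γ d × s ≤ d))
    × (G ⊑ IsAutomorphism Γ)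
    × (∀ v i → 1 ≤ i → i ≤ s →
         TransitiveOn (Stabiliser G v) (λ w → Distance Γ v w i))

  IsStarlike : Subset n → ℕ → PermGroup n → Set
  IsStarlike B r N =
      Connected Γ
    × IsBipartition Γ B
    × (N ⊑ IsAutomorphism Γ)
    × TransitiveOn N (_∈ B)
    × HasOrbits N (_∉ B) r

------------------------------------------------------------------------
-- Designs

-- Points and blocks share the carrier Fin n, the blocks being the
-- elements outside points, so that an automorphism is one permutation.
record Design (n : ℕ) : Set₁ where
  field
    points    : Subset n
    Inc       : Rel (Fin n) 0ℓ
    inc?      : Decidable Inc
    inc⇒point : ∀ {p b} → Inc p b → p ∈ points
    inc⇒block : ∀ {p b} → Inc p b → b ∉ points

module _ {n : ℕ} (D : Design n) where
  open Design D

  IsDesignAutomorphism : Pred (Permutation′ n) 0ℓ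
  IsDesignAutomorphism π =
      (∀ x → x ∈ points ⇔ π ⟨$⟩ʳ x ∈ points)
    × (∀ p b → Inc p b ⇔ Inc (π ⟨$⟩ʳ p) (π ⟨$⟩ʳ b))

  commonPoints : Fin n → Fin n → ℕ
  commonPoints b c = length (filter (λ p → inc? p b ×-dec inc? p c) (allFin n))

  IsNicelyAffine : PermGroup n → Set
  IsNicelyAffine N =
      (N ⊑ IsDesignAutomorphism)
    × TransitiveOn N (_∈ points)
    × (∃[ μ ] (∀ {b c} → b ∉ points → c ∉ points → b ≢ c →
         (¬ SameOrbit N b c → commonPoints b c ≡ μ)
       × (SameOrbit N b c → commonPoints b c ≡ 0)))

  HasParallelClasses : PermGroup n → ℕ → Set
  HasParallelClasses N r = HasOrbits N (_∉ points) r

adjacencyDesign : ∀ {n} → Graph n → Subset n → Design n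
adjacencyDesign Γ B = record
  { points    = B
  ; Inc       = λ p b → p ∈ B × b ∉ B × Adj p b
  ; inc?      = λ p b → (p ∈? B) ×-dec (¬? (b ∈? B) ×-dec adj? p b)
  ; inc⇒point = proj₁
  ; inc⇒block = λ i → proj₁ (proj₂ i)
  }
  where open Graph Γ

{-# OPTIONS --safe #-}
-- Two distinct vertices of B′ at distance 2 lie in different N-orbits: a
-- common neighbour meets all r ≥ 2 orbits, so Γ₂(v) leaves the orbit of v, and
-- G_v permutes the N-orbits while fixing that of v.  If Γ₄(v) had no vertex in
-- the orbit of v, then Γ(w) ⊆ Γ(v) for all w in Γ₂(v), and Γ would be complete
-- bipartite.  Hence s ≥ 4 forces Γ₄(v) into the orbit of v.  A third orbit then
-- rules out distance 6 within B′, so vertices of B′ are at distance 4 or 2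
-- according to whether or not they share an N-orbit.
module Submission where

open import Data.Fin.Base using (Fin; zero; suc; fromℕ<)
open import Data.Fin.Permutation
  using (Permutation′; _⟨$⟩ʳ_; _⟨$⟩ˡ_; inverseˡ; inverseʳ; flip; _∘ₚ_)
open import Data.Fin.Properties using (_≟_; any?)
open import Data.Fin.Subset using (Subset; _∈_; _∉_)
open import Data.Fin.Subset.Properties using (_∈?_)
open import Data.List.Base using (allFin; filter; length; map)
open import Data.List.Membership.Propositional using () renaming (_∈_ to _∈ˡ_)
open import Data.List.Membership.Propositional.Properties
  using (∈-allFin; ∈-filter⁺; ∈-filter⁻; ∈-map⁺; ∈-map⁻)
open import Data.List.Membership.Propositional.Properties.WithK
  using (unique∧set⇒bag)
open import Data.List.Properties using (length-map; filter-≐; filter-none)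
open import Data.List.Relation.Binary.BagAndSetEquality using (∼bag⇒↭)
open import Data.List.Relation.Binary.Permutation.Propositional.Properties
  using (↭-length)
open import Data.List.Relation.Unary.All using (universal)
open import Data.List.Relation.Unary.Unique.Propositional.Properties
  using (map⁺; allFin⁺; filter⁺)
open import Data.Nat.Base using (ℕ; _≤_; z≤n; s≤s)
open import Data.Nat.Properties using (≤-refl; ≤-trans; _≤?_; ≰⇒≥)
open import Data.Product.Base using (∃-syntax; _×_; _,_; proj₁; proj₂)
open import Data.Sum.Base using (inj₁; inj₂)
open import Function.Base using (_∘_)
open import Function.Bundles using (Equivalence; Bijection; mk⇔)
open import Level using (0ℓ)
open import Relation.Binary.PropositionalEquality
  using (_≡_; _≢_; refl; sym; trans; cong; subst; module ≡-Reasoning)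
open import Relation.Nullary.Decidable
  using (Dec; yes; no; map′; ¬?; _×-dec_; decidable-stable)
open import Relation.Nullary.Negation using (¬_; contradiction)
open import Relation.Unary using (Pred; Decidable)
open import Defs

open PermGroup using (Mem; flip-mem)

-- Choosing and counting in finite sets.

distinct-from-two : ∀ {r} → 3 ≤ r → (i j : Fin r) → ∃[ k ] (i ≢ k × j ≢ k)
distinct-from-two (s≤s (s≤s (s≤s _))) zero          zero          = suc zero , (λ ()) , λ ()
distinct-from-two (s≤s (s≤s (s≤s _))) zero          (suc zero)    = suc (suc zero) , (λ ()) , λ ()
distinct-from-two (s≤s (s≤s (s≤s _))) zero          (suc (suc _)) = suc zero , (λ ()) , λ ()
distinct-from-two (s≤s (s≤s (s≤s _))) (suc zero)    zero          = suc (suc zero) , (λ ()) , λ ()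
distinct-from-two (s≤s (s≤s (s≤s _))) (suc (suc _)) zero          = suc zero , (λ ()) , λ ()
distinct-from-two (s≤s (s≤s (s≤s _))) (suc _)       (suc _)       = zero , (λ ()) , λ ()

-- The image of the first list under `π` and the second list are duplicate-free with the same
-- members, hence rearrangements of each other.
length-filter-permute :
  ∀ {n p q} {P : Pred (Fin n) p} {Q : Pred (Fin n) q} (P? : Decidable P) (Q? : Decidable Q)
  (π : Permutation′ n) →
  (∀ {i} → P i → Q (π ⟨$⟩ʳ i)) → (∀ {i} → Q (π ⟨$⟩ʳ i) → P i) →
  length (filter P? (allFin n)) ≡ length (filter Q? (allFin n))
length-filter-permute {n} {Q = Q} P? Q? π P⇒Q Q⇒P = trans
  (sym (length-map (π ⟨$⟩ʳ_) ps))
  (↭-length (∼bag⇒↭ (unique∧set⇒bag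
    (map⁺ injective (filter⁺ P? (allFin⁺ n)))
    (filter⁺ Q? (allFin⁺ n))
    (mk⇔ to from))))
  where
  ps = filter P? (allFin n)
  qs = filter Q? (allFin n)
  injective : ∀ {i j} → π ⟨$⟩ʳ i ≡ π ⟨$⟩ʳ j → i ≡ j
  injective eq = trans (sym (inverseˡ π)) (trans (cong (π ⟨$⟩ˡ_) eq) (inverseˡ π))
  to : ∀ {j} → j ∈ˡ map (π ⟨$⟩ʳ_) ps → j ∈ˡ qs
  to j∈ with ∈-map⁻ (π ⟨$⟩ʳ_) j∈
  ... | i , i∈ , refl =
    ∈-filter⁺ Q? (∈-allFin _) (P⇒Q (proj₂ (∈-filter⁻ P? {xs = allFin n} i∈)))
  from : ∀ {j} → j ∈ˡ qs → j ∈ˡ map (π ⟨$⟩ʳ_) ps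
  from {j} j∈ = subst (_∈ˡ map (π ⟨$⟩ʳ_) ps) (inverseʳ π)
    (∈-map⁺ (π ⟨$⟩ʳ_) (∈-filter⁺ P? (∈-allFin _)
      (Q⇒P (subst Q (sym (inverseʳ π)) (proj₂ (∈-filter⁻ Q? {xs = allFin n} j∈))))))

-- Walks and diameters.

infixr 5 _◅_
-- Defs gives _∷_ no fixity.
pattern _◅_ e p = e ∷ p

module _ {n : ℕ} (Γ : Graph n) where
  open Graph Γ

  -- By connectedness, a vertex without neighbours would be the only vertex, so `a` and `b` would
  -- coincide and the diameter would be 0.
  diameter⇒neighbour : ∀ {d} → Connected Γ → HasDiameter Γ d → 1 ≤ d →
    ∀ v → ∃[ u ] Adj v u
  diameter⇒neighbour connected (_ , a , b , _ , minimal) 1≤d v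
    with connected v a | connected v b
  ... | _ , e ◅ _ | _         = _ , e
  ... | _ , []    | _ , e ◅ _ = _ , e
  ... | _ , []    | _ , []    = contradiction (≤-trans 1≤d (minimal 0 [])) λ ()

  diameter-≤ : ∀ {d e} → HasDiameter Γ d → HasDiameter Γ e → d ≤ e
  diameter-≤ (_ , u , v , _ , minimal) (distance , _) with distance u v
  ... | k , (p , _) , k≤e = ≤-trans (minimal k p) k≤e

-- Distances and sides in a bipartite graph.

module Bipartite {n : ℕ} (Γ : Graph n) {B : Subset n} (bip : IsBipartition Γ B) where
  open Graph Γ

  -- Distance 2, or distance 0 for a vertex that has a neighbour; hence `v ≢ w` accompanies it where
  -- distance exactly 2 is meant.
  Near : Fin n → Fin n → Set
  Near v w = ∃[ u ] (Adj v u × Adj u w)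

  near? : ∀ v w → Dec (Near v w)
  near? v w = any? λ u → adj? v u ×-dec adj? u w

  ∈⇒∉ : ∀ {u v} → Adj u v → u ∈ B → v ∉ B
  ∈⇒∉ e u∈B with bip e
  ... | inj₁ (_ , v∉B) = v∉B
  ... | inj₂ (u∉B , _) = contradiction u∈B u∉B

  ∉⇒∈ : ∀ {u v} → Adj u v → u ∉ B → v ∈ B
  ∉⇒∈ e u∉B with bip e
  ... | inj₁ (u∈B , _) = contradiction u∈B u∉B
  ... | inj₂ (_ , v∈B) = v∈B

  near-∉ : ∀ {v w} → v ∉ B → Near v w → w ∉ B
  near-∉ v∉B (_ , e , f) = ∈⇒∉ f (∉⇒∈ e v∉B)

  distance-1 : ∀ {v w} → Adj v w → Distance Γ v w 1
  distance-1 e = e ◅ [] , λ where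
    _ []      → contradiction e loopless
    _ (_ ◅ _) → s≤s z≤n

  distance-2 : ∀ {v w} → v ∉ B → v ≢ w → Near v w → Distance Γ v w 2
  distance-2 v∉B v≢w near@(_ , e , f) = e ◅ f ◅ [] , λ where
    _ []          → contradiction refl v≢w
    _ (e′ ◅ [])   → contradiction (∉⇒∈ e′ v∉B) (near-∉ v∉B near)
    _ (_ ◅ _ ◅ _) → s≤s (s≤s z≤n)

  distance-4 : ∀ {v w x} → v ∉ B → v ≢ x → ¬ Near v x → Near v w → Near w x →
    Distance Γ v x 4
  distance-4 {v} {x = x} v∉B v≢x ¬near near@(_ , e , f) near′@(_ , e′ , f′) =
    e ◅ f ◅ e′ ◅ f′ ◅ [] , minimal
    where
    x∉B : x ∉ B
    x∉B = near-∉ (near-∉ v∉B near) near′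
    minimal : ∀ j → Walk Γ v x j → 4 ≤ j
    minimal _ []                  = contradiction refl v≢x
    minimal _ (a ◅ [])            = contradiction (∉⇒∈ a v∉B) x∉B
    minimal _ (a ◅ b ◅ [])        = contradiction (_ , a , b) ¬near
    minimal _ (a ◅ b ◅ c ◅ [])    = contradiction (∉⇒∈ c (near-∉ v∉B (_ , a , b))) x∉B
    minimal _ (_ ◅ _ ◅ _ ◅ _ ◅ _) = s≤s (s≤s (s≤s (s≤s z≤n)))

  -- A walk between vertices outside `B` has even length, so it splits into `Near` steps along which
  -- `P` propagates.
  near-induction : Connected Γ → (P : Pred (Fin n) 0ℓ) →
    (∀ {z z′} → z ∉ B → P z → Near z z′ → P z′) →
    ∀ {v w} → v ∉ B → w ∉ B → P v → P w
  near-induction connected P step {v} v∉B w∉B = go v∉B w∉B (proj₂ (connected v _))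
    where
    go : ∀ {v w k} → v ∉ B → w ∉ B → Walk Γ v w k → P v → P w
    go v∉B w∉B []          Pv = Pv
    go v∉B w∉B (e ◅ [])    Pv = contradiction (∉⇒∈ e v∉B) w∉B
    go v∉B w∉B (e ◅ f ◅ p) Pv =
      go (near-∉ v∉B (_ , e , f)) w∉B p (step v∉B Pv (_ , e , f))

  SameSide : Fin n → Fin n → Set
  SameSide u v = (u ∈ B → v ∈ B) × (v ∈ B → u ∈ B)

  walk-sameSide : ∀ {g} → IsAutomorphism Γ g → ∀ {u v k} → Walk Γ u v k →
    SameSide u (g ⟨$⟩ʳ u) → SameSide v (g ⟨$⟩ʳ v)
  walk-sameSide aut []                    same = same
  walk-sameSide {g} aut (_∷_ {u} {v} e p) (to , from) =
    walk-sameSide {g} aut p (to′ , from′)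
    where
    e′ = Equivalence.to (aut u v) e
    to′ : v ∈ B → g ⟨$⟩ʳ v ∈ B
    to′ v∈B = ∉⇒∈ e′ λ gu∈B → ∈⇒∉ (symmetric e) v∈B (from gu∈B)
    from′ : g ⟨$⟩ʳ v ∈ B → v ∈ B
    from′ gv∈B = ∉⇒∈ e λ u∈B → ∈⇒∉ (symmetric e′) gv∈B (to u∈B)

  -- An automorphism of a bipartite graph can in general interchange the sides. One fixing `u`
  -- cannot: along a walk from `u`, each edge and its image both change sides.
  fixing⇒sameSide : Connected Γ → ∀ {g u} → IsAutomorphism Γ g → g ⟨$⟩ʳ u ≡ u →
    ∀ v → SameSide v (g ⟨$⟩ʳ v)
  fixing⇒sameSide connected {g} {u} aut gu≡u v = walk-sameSide {g} aut
    (proj₂ (connected u v)) (subst (_∈ B) (sym gu≡u) , subst (_∈ B) gu≡u)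

-- Orbits of `N` and local distance transitivity.

module Starlike
  {n r : ℕ} (Γ : Graph n) {B : Subset n} {N G : PermGroup n}
  (3≤r : 3 ≤ r) (starlike : IsStarlike Γ B r N)
  (N◁G : N ◁ G) (G-aut : G ⊑ IsAutomorphism Γ)
  (neighbour : ∀ v → ∃[ u ] Graph.Adj Γ v u)
  (sphere₁ : ∀ v → TransitiveOn (Stabiliser G v) (λ w → Distance Γ v w 1))
  (sphere₂ : ∀ v → TransitiveOn (Stabiliser G v) (λ w → Distance Γ v w 2))
  where

  open Graph Γ

  connected : Connected Γ
  connected = proj₁ starlike

  bip : IsBipartition Γ B
  bip = proj₁ (proj₂ starlike)

  N-aut : N ⊑ IsAutomorphism Γ
  N-aut = proj₁ (proj₂ (proj₂ starlike))

  N-transitive : TransitiveOn N (_∈ B)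
  N-transitive = proj₁ (proj₂ (proj₂ (proj₂ starlike)))

  N-orbits : HasOrbits N (_∉ B) r
  N-orbits = proj₂ (proj₂ (proj₂ (proj₂ starlike)))

  open Bipartite Γ bip
  open Bijection (proj₂ N-orbits) using (to; injective; strictlySurjective)
    renaming (cong to to-cong)

  infix 4 _~_ _≁_
  _~_ _≁_ : Fin n → Fin n → Set
  _~_ = SameOrbit N
  v ≁ w = ¬ v ~ w

  ~-sym : ∀ {v w} → v ~ w → w ~ v
  ~-sym (g , m , refl) = flip g , flip-mem N m , inverseˡ g

  ~-trans : ∀ {v w x} → v ~ w → w ~ x → v ~ x
  ~-trans (g , m , refl) (h , m′ , refl) = g ∘ₚ h , PermGroup.∘ₚ-mem N m m′ , refl

  ~-refl : ∀ {v} → v ~ v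
  ~-refl = _ , PermGroup.id-mem N , refl

  ≁⇒≢ : ∀ {v w} → v ≁ w → v ≢ w
  ≁⇒≢ v≁w refl = v≁w ~-refl

  ~-dec : ∀ {v w} → v ∉ B → w ∉ B → Dec (v ~ w)
  ~-dec v∉B w∉B = map′ injective to-cong (to (_ , v∉B) ≟ to (_ , w∉B))

  -- An element of `N` carrying a neighbour of `c` to `u` carries `c` to a neighbour of `u`. Thus
  -- the neighbours of any point meet every orbit on blocks.
  adjacent-orbit : ∀ {u c} → u ∈ B → c ∉ B → ∃[ w ] (Adj u w × c ~ w)
  adjacent-orbit {u} {c} u∈B c∉B with neighbour c
  ... | x , e with proj₂ N-transitive (∉⇒∈ e c∉B) u∈B
  ... | h , m , refl = h ⟨$⟩ʳ c , symmetric (Equivalence.to (N-aut m c x) e) , h , m , refl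

  adjacent-other-orbit : ∀ {u a b} → u ∈ B → a ∉ B → b ∉ B →
    ∃[ w ] (Adj u w × a ≁ w × b ≁ w)
  adjacent-other-orbit u∈B a∉B b∉B
    with distinct-from-two 3≤r (to (_ , a∉B)) (to (_ , b∉B))
  ... | k , a≢k , b≢k with strictlySurjective k
  ... | (c , c∉B) , refl with adjacent-orbit u∈B c∉B
  ... | w , e , c~w = w , e
    , (λ a~w → a≢k (to-cong (~-trans a~w (~-sym c~w))))
    , (λ b~w → b≢k (to-cong (~-trans b~w (~-sym c~w))))

  stabiliser-orbit : ∀ {g v w} → Mem G g → g ⟨$⟩ʳ v ≡ v → v ~ w → v ~ g ⟨$⟩ʳ w
  stabiliser-orbit {g} m gv≡v (h , m′ , refl) =
    -- Composition runs left to right: this conjugate lies in `N` by normality and takes `v` to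
    -- itself, then to `w`, then to the image of `w` under `g`.
    flip g ∘ₚ h ∘ₚ g , proj₂ N◁G m m′ ,
    cong (λ x → g ⟨$⟩ʳ (h ⟨$⟩ʳ x)) (trans (cong (g ⟨$⟩ˡ_) (sym gv≡v)) (inverseˡ g))

  transport : ∀ {v w w′} → v ∉ B → v ≢ w → Near v w → v ≢ w′ → Near v w′ →
    SameOrbit (Stabiliser G v) w w′
  transport v∉B v≢w near v≢w′ near′ =
    proj₂ (sphere₂ _) (distance-2 v∉B v≢w near) (distance-2 v∉B v≢w′ near′)

  near⇒≁ : ∀ {v w} → v ∉ B → v ≢ w → Near v w → v ≁ w
  near⇒≁ v∉B v≢w near@(u , e , f) v~w with adjacent-other-orbit (∉⇒∈ e v∉B) v∉B v∉B
  ... | w′ , f′ , v≁w′ , _ with transport v∉B v≢w near (≁⇒≢ v≁w′) (u , e , f′)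
  ... | g , (m , gv≡v) , refl = v≁w′ (stabiliser-orbit {g} m gv≡v v~w)

  pull-adj : ∀ {g w x} → Mem G g → Adj (g ⟨$⟩ʳ w) x → Adj w (g ⟨$⟩ˡ x)
  pull-adj {g} m e = Equivalence.from (G-aut m _ _) (subst (Adj _) (sym (inverseʳ g)) e)

  push-adj : ∀ {g w x} → Mem G g → Adj w (g ⟨$⟩ˡ x) → Adj (g ⟨$⟩ʳ w) x
  push-adj {g} m e = subst (Adj _) (inverseʳ g) (Equivalence.to (G-aut m _ _) e)

  -- Nested neighbourhoods force completeness.

  module _ {v w : Fin n} (v∉B : v ∉ B) (v≢w : v ≢ w) (near : Near v w)
    (Γw⊆Γv : ∀ x → Adj w x → Adj v x) where

    -- Transitivity of `G_v` on the sphere of radius 2 spreads the inclusion of neighbourhoods from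
    -- `w` to every `z` in that sphere.
    near-subset : ∀ {z x} → v ≢ z → Near v z → Adj z x → Adj v x
    near-subset {x = x} v≢z near′ e with transport v∉B v≢w near v≢z near′
    ... | g , (m , gv≡v) , refl =
      subst (λ y → Adj y x) gv≡v (push-adj {g} m (Γw⊆Γv _ (pull-adj {g} m e)))

    near-everything : ∀ {z} → z ∉ B → Near v z
    near-everything z∉B = near-induction connected (Near v) step v∉B z∉B
      (_ , proj₂ (neighbour v) , symmetric (proj₂ (neighbour v)))
      where
      step : ∀ {z z′} → z ∉ B → Near v z → Near z z′ → Near v z′
      step {z} _ near′ (x , e , f) with v ≟ z
      ... | yes refl = x , e , f
      ... | no v≢z   = x , near-subset v≢z near′ e , f

    adjacent-everything : ∀ {x} → x ∈ B → Adj v x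
    adjacent-everything {x} x∈B with neighbour x
    ... | z , e with v ≟ z
    ... | yes refl = symmetric e
    ... | no v≢z   = near-subset v≢z (near-everything (∈⇒∉ e x∈B)) (symmetric e)

    subset⇒complete : IsCompleteBipartite Γ
    subset⇒complete = B , bip , λ x∈B z∉B → symmetric (complete z∉B x∈B)
      where
      complete : ∀ {z x} → z ∉ B → x ∈ B → Adj z x
      complete {x = x} z∉B x∈B with near-everything z∉B
      -- `v` and `z` share the neighbour `u`, so some element of `G_u` carries `v` to `z`. It
      -- preserves `B`, so `z` inherits from `v` the adjacency to all of `B`.
      ... | u , e , f with proj₂ (sphere₁ u) (distance-1 (symmetric e)) (distance-1 f)
      ... | g , (m , gu≡u) , refl = push-adj {g} m (adjacent-everything
        (proj₂ (fixing⇒sameSide connected {g} (G-aut m) gu≡u _)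
          (subst (_∈ B) (sym (inverseʳ g)) x∈B)))

  distance-4-same-orbit : ¬ IsCompleteBipartite Γ →
    ∀ {v} → v ∉ B → ∃[ y ] (Distance Γ v y 4 × v ~ y)
  distance-4-same-orbit incomplete {v} v∉B with neighbour v
  ... | u , e with adjacent-other-orbit (∉⇒∈ e v∉B) v∉B v∉B
  ... | w , f , v≁w , _ with any? (λ x → adj? w x ×-dec ¬? (adj? v x))
  ... | no none = contradiction
    (subset⇒complete v∉B (≁⇒≢ v≁w) (u , e , f)
      (λ x a → decidable-stable (adj? v x) λ ¬a → none (x , a , ¬a)))
    incomplete
  -- `x` is adjacent to `w` but not to `v`. Its neighbour `y` in the orbit of `v` therefore differs
  -- from `v`, and `near⇒≁` rules out distance 2.
  ... | yes (x , a , ¬a) with adjacent-orbit (∉⇒∈ a (near-∉ v∉B (u , e , f))) v∉B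
  ... | y , b , v~y = y , distance-4 v∉B v≢y (λ near → near⇒≁ v∉B v≢y near v~y)
                            (u , e , f) (x , a , b) , v~y
    where
    v≢y : v ≢ y
    v≢y refl = ¬a (symmetric b)

  -- Consequences of transitivity on spheres of radius 4.

  module DistanceFour
    (incomplete : ¬ IsCompleteBipartite Γ)
    (sphere₄ : ∀ v → TransitiveOn (Stabiliser G v) (λ w → Distance Γ v w 4))
    where

    distance-4⇒~ : ∀ {v y} → v ∉ B → Distance Γ v y 4 → v ~ y
    distance-4⇒~ v∉B dist with distance-4-same-orbit incomplete v∉B
    ... | y′ , dist′ , v~y′ with proj₂ (sphere₄ _) dist′ dist
    ... | g , (m , gv≡v) , refl = stabiliser-orbit {g} m gv≡v v~y′

    -- Contrapositive of `distance-4⇒~`: the ends of two `Near` steps, if in different orbits, are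
    -- distinct and not at distance 4, which leaves distance 2.
    near-trans : ∀ {a b c} → a ∉ B → a ≁ c → Near a b → Near b c → Near a c
    near-trans {a} {c = c} a∉B a≁c ab bc = decidable-stable (near? a c) λ ¬ac →
      a≁c (distance-4⇒~ a∉B (distance-4 a∉B (≁⇒≢ a≁c) ¬ac ab bc))

    Near² : Fin n → Fin n → Set
    Near² a d = ∃[ c ] (Near a c × Near c d)

    -- Three `Near` steps shorten to two, which excludes distance 6. With the names of the clause,
    -- if `a` and `c`, or `b` and `d`, lie in different orbits, `near-trans` merges two consecutive
    -- steps.
    near²-step : ∀ {a d d′} → a ∉ B → d ∉ B → Near² a d → Near d d′ → Near² a d′
    near²-step {a} {c} {d} a∉B c∉B (b , ab , bc) cd@(x , e , f)
      with ~-dec a∉B c∉B | ~-dec b∉B d∉B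
      where b∉B = near-∉ a∉B ab
            d∉B = near-∉ c∉B cd
    ... | no a≁c | _      = c , near-trans a∉B a≁c ab bc , cd
    ... | _      | no b≁d = b , ab , near-trans (near-∉ a∉B ab) b≁d bc cd
    -- Here a, c and b, d share orbits; a neighbour of x in a third orbit
    -- shortcuts the path.
    ... | yes _  | yes _ with adjacent-other-orbit (∉⇒∈ e c∉B) a∉B (near-∉ a∉B ab)
    ... | z , h , a≁z , b≁z =
      z , near-trans a∉B a≁z ab (near-trans (near-∉ a∉B ab) b≁z bc (x , e , h))
        , (x , symmetric h , f)

    near² : ∀ {a d} → a ∉ B → d ∉ B → Near² a d
    near² {a} a∉B d∉B = near-induction connected (Near² a) (near²-step a∉B) a∉B d∉B
      -- The induction starts at `a` itself, reached by going to a neighbour and back, twice.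
      (a , loop , loop)
      where loop = _ , proj₂ (neighbour a) , symmetric (proj₂ (neighbour a))

    ≁⇒near : ∀ {a c} → a ∉ B → c ∉ B → a ≁ c → Near a c
    ≁⇒near a∉B c∉B a≁c with near² a∉B c∉B
    ... | _ , ab , bc = near-trans a∉B a≁c ab bc

    walk-from-∈ : ∀ {u v} → u ∈ B → v ∉ B → Walk Γ u v 3
    -- Choosing `w` outside the orbit of `v` makes `w` and `v` `Near`, which gives one edge plus
    -- two.
    walk-from-∈ u∈B v∉B with adjacent-other-orbit u∈B v∉B v∉B
    ... | w , e , v≁w , _ with ≁⇒near (∈⇒∉ e u∈B) v∉B (v≁w ∘ ~-sym)
    ... | _ , f , h = e ◅ f ◅ h ◅ []

    short-walk : ∀ u v → ∃[ k ] (Walk Γ u v k × k ≤ 4)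
    short-walk u v with u ∈? B | v ∈? B
    ... | yes u∈B | no v∉B  = 3 , walk-from-∈ u∈B v∉B , s≤s (s≤s (s≤s z≤n))
    ... | no u∉B  | no v∉B  with near² u∉B v∉B
    ... | _ , (_ , a , b) , (_ , c , d) = 4 , a ◅ b ◅ c ◅ d ◅ [] , ≤-refl
    short-walk u v | yes u∈B | yes v∈B with neighbour u
    ... | w , e with walk-from-∈ v∈B (∈⇒∉ e u∈B)
    ... | a ◅ b ◅ c ◅ [] =
      4 , e ◅ symmetric c ◅ symmetric b ◅ symmetric a ◅ [] , ≤-refl
    short-walk u v | no u∉B | yes v∈B with walk-from-∈ v∈B u∉B
    ... | a ◅ b ◅ c ◅ [] =
      3 , symmetric c ◅ symmetric b ◅ symmetric a ◅ [] , s≤s (s≤s (s≤s z≤n))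

    diameter-4 : ∀ {d} → HasDiameter Γ d → HasDiameter Γ 4
    diameter-4 (distance , _) = bounded , v , attained
      where
      -- `3≤r` reads as `2 < r`; the orbit so indexed serves to supply a vertex outside `B`.
      v = proj₁ (proj₁ (strictlySurjective (fromℕ< 3≤r)))
      v∉B = proj₂ (proj₁ (strictlySurjective (fromℕ< 3≤r)))
      attained : ∃[ y ] Distance Γ v y 4
      attained with distance-4-same-orbit incomplete v∉B
      ... | y , dist , _ = y , dist
      bounded : ∀ u w → ∃[ k ] (Distance Γ u w k × k ≤ 4)
      bounded u w with distance u w | short-walk u w
      ... | k , dist@(_ , minimal) , _ | j , p , j≤4 = k , dist , ≤-trans (minimal j p) j≤4

    -- The adjacency design.

    D : Design n
    D = adjacencyDesign Γ B

    commonPoints-sym : ∀ b c → commonPoints D b c ≡ commonPoints D c b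
    commonPoints-sym b c =
      cong length (filter-≐ _ _ ((λ (i , j) → j , i) , λ (i , j) → j , i) (allFin n))

    adj⇒inc : ∀ {p b} → b ∉ B → Adj p b → Design.Inc D p b
    adj⇒inc b∉B e = ∉⇒∈ (symmetric e) b∉B , b∉B , e

    -- By `≁⇒near` both `w` and `w′` are at distance 2 from `v`, so an element of `G_v` takes `w` to
    -- `w′` and maps common points onto common points.
    commonPoints-cong : ∀ {v w w′} → v ∉ B → w ∉ B → w′ ∉ B → v ≁ w → v ≁ w′ →
      commonPoints D v w ≡ commonPoints D v w′
    commonPoints-cong {v} {w} v∉B w∉B w′∉B v≁w v≁w′
      with transport v∉B (≁⇒≢ v≁w) (≁⇒near v∉B w∉B v≁w)
                         (≁⇒≢ v≁w′) (≁⇒near v∉B w′∉B v≁w′)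
    ... | g , (m , gv≡v) , refl = length-filter-permute _ _ g
      (λ { ((_ , _ , e) , (_ , _ , f)) →
           adj⇒inc v∉B (subst (Adj _) gv≡v (Equivalence.to (G-aut m _ _) e))
         , adj⇒inc w′∉B (Equivalence.to (G-aut m _ _) f) })
      (λ { ((_ , _ , e) , (_ , _ , f)) →
           adj⇒inc v∉B (Equivalence.from (G-aut m _ _) (subst (Adj _) (sym gv≡v) e))
         , adj⇒inc w∉B (Equivalence.from (G-aut m _ _) f) })

    -- One block is replaced at a time, always keeping the two in different orbits. A block `x` from
    -- an orbit other than those of `v` and `v′` links the two pairs.
    commonPoints-constant : ∀ {v w v′ w′} → v ∉ B → w ∉ B → v′ ∉ B → w′ ∉ B →
      v ≁ w → v′ ≁ w′ → commonPoints D v w ≡ commonPoints D v′ w′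
    commonPoints-constant {v} {w} {v′} {w′} v∉B w∉B v′∉B w′∉B v≁w v′≁w′
      with distinct-from-two 3≤r (to (_ , v∉B)) (to (_ , v′∉B))
    ... | k , v≢k , v′≢k with strictlySurjective k
    ... | (x , x∉B) , refl = begin
      commonPoints D v w   ≡⟨ commonPoints-cong v∉B w∉B x∉B v≁w v≁x ⟩
      commonPoints D v x   ≡⟨ commonPoints-sym v x ⟩
      commonPoints D x v   ≡⟨ commonPoints-cong x∉B v∉B v′∉B (v≁x ∘ ~-sym) (v′≁x ∘ ~-sym) ⟩
      commonPoints D x v′  ≡⟨ commonPoints-sym x v′ ⟩
      commonPoints D v′ x  ≡⟨ commonPoints-cong v′∉B x∉B w′∉B v′≁x v′≁w′ ⟩
      commonPoints D v′ w′ ∎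
      where
      open ≡-Reasoning
      v≁x : v ≁ x
      v≁x v~x = v≢k (to-cong v~x)
      v′≁x : v′ ≁ x
      v′≁x v′~x = v′≢k (to-cong v′~x)

    commonPoints-parallel : ∀ {b c} → b ∉ B → b ≢ c → b ~ c → commonPoints D b c ≡ 0
    commonPoints-parallel b∉B b≢c b~c = cong length (filter-none _ (universal
      (λ { p ((_ , _ , e) , (_ , _ , f)) → near⇒≁ b∉B b≢c (p , symmetric e , f) b~c })
      (allFin n)))

    N-design-aut : N ⊑ IsDesignAutomorphism D
    N-design-aut {g} m = (λ x → mk⇔ (proj₁ N-transitive m) (reflect x))
      , λ p b → mk⇔
          (λ { (p∈B , b∉B , e) → proj₁ N-transitive m p∈B , proj₁ N-orbits m b∉B
             , Equivalence.to (N-aut m p b) e })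
          (λ { (p∈B , b∉B , e) → reflect p p∈B
             , b∉B ∘ proj₁ N-transitive m , Equivalence.from (N-aut m p b) e })
      where
      reflect : ∀ x → g ⟨$⟩ʳ x ∈ B → x ∈ B
      reflect x gx∈B = decidable-stable (x ∈? B) λ x∉B → proj₁ N-orbits m x∉B gx∈B

    nicelyAffine : IsNicelyAffine D N
    nicelyAffine with strictlySurjective (fromℕ< 3≤r)
    ... | (v , v∉B) , _ with distinct-from-two 3≤r (to (_ , v∉B)) (to (_ , v∉B))
    ... | k , v≢k , _ with strictlySurjective k
    ... | (w , w∉B) , refl =
      -- `μ` is read off from one reference pair `v`, `w` of blocks in different orbits.
      (λ {g} → N-design-aut {g}) , N-transitive , commonPoints D v w , λ b∉B c∉B b≢c →
          (λ b≁c → commonPoints-constant b∉B c∉B v∉B w∉B b≁c (v≢k ∘ to-cong))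
        , commonPoints-parallel b∉B b≢c

proposition4p5 : (r s : ℕ) → 3 ≤ r → 2 ≤ s →
    {n : ℕ} (Γ : Graph n) (B : Subset n) →
    Connected Γ → IsBipartition Γ B → ¬ IsCompleteBipartite Γ →
    (N G : PermGroup n) →
    ¬ IsTrivial N → N ◁ G → G ⊑ IsAutomorphism Γ →
    IsStarlike Γ B r N → IsLocallyDistanceTransitive Γ G s →
    (s ≤ 4) ×
    (s ≡ 4 →
    IsNicelyAffine (adjacencyDesign Γ B) N ×
    HasParallelClasses (adjacencyDesign Γ B) N r ×
    HasDiameter Γ 4)
proposition4p5 r s 3≤r 2≤s Γ B connected _ incomplete N G _ N◁G G-aut starlike
  ((d , diam , s≤d) , _ , transitive) = s≤4 , λ { refl → conclusion ≤-refl }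
  where
  module S = Starlike Γ {N = N} {G} 3≤r starlike N◁G G-aut
    (diameter⇒neighbour Γ connected diam (≤-trans (s≤s z≤n) (≤-trans 2≤s s≤d)))
    (λ v → transitive v 1 ≤-refl (≤-trans (s≤s z≤n) 2≤s))
    (λ v → transitive v 2 (s≤s z≤n) 2≤s)

  -- Assuming `4 ≤ s` rather than `s ≡ 4` lets the same result serve the bound on `s`.
  conclusion : 4 ≤ s →
    IsNicelyAffine (adjacencyDesign Γ B) N ×
    HasParallelClasses (adjacencyDesign Γ B) N r ×
    HasDiameter Γ 4
  conclusion 4≤s = nicelyAffine , S.N-orbits , diameter-4 diam
    where open S.DistanceFour incomplete (λ v → transitive v 4 (s≤s z≤n) 4≤s)

  s≤4 : s ≤ 4
  s≤4 with s ≤? 4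
  ... | yes s≤4 = s≤4
  -- Here too `conclusion` gives diameter 4, so `s ≤ d ≤ 4`.
  ... | no s≰4 = ≤-trans s≤d (diameter-≤ Γ diam (proj₂ (proj₂ (conclusion (≰⇒≥ s≰4)))))
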